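{- Let $\mathbf{L}$ be an intermediate propositional logic. If $\varepsilon\tau(\mathbf{L})$ has the first $\varepsilon\tau$-theorem, then $\vdash_{\mathbf{L}}B_m$ for some $m\ge 2$.
   Context: An intermediate propositional logic is a set of propositional formulas containing intuitionistic propositional logic, contained in classical logic, closed under modus ponens and substitution. $\vdash_{\mathbf{L}}A$ (for quantifier-free formulas of a first-order language) means $A$ is derivable using substitution instances of formulas of $\mathbf{L}$ and modus ponens. $\varepsilon\tau$-terms: for any formula $A(x)$, $\varepsilon x\,A(x)$ and $\tau x\,A(x)$ are terms. Critical formulas: $A(t)\to A(\varepsilon x\,A(x))$ and $A(\tau x\,A(x))\to A(t)$, $t$ any term. $\vdash_{\varepsilon\tau(\mathbf{L})}B$ means $B$ is derivable (quantifier-free language with $\varepsilon\tau$-terms) from critical formulas using substitution instances of $\mathbf{L}$ and modus ponens. A term is $\varepsilon\tau$-free if it contains no $\varepsilon\tau$-terms. $\varepsilon\tau(\mathbf{L})$ has the first $\varepsilon\tau$-theorem if whenever $\vdash_{\varepsilon\tau(\mathbf{L})}A(e_1,\dots,e_n)$ for some $\varepsilon$- or $\tau$-terms $e_1,\dots,e_n$, there are $\varepsilon\tau$-free terms $t_i^j$ such that $\vdash_{\mathbf{L}}A(t_1^1,\dots,t_n^1)\lor\dots\lor A(t_1^k,\dots,t_n^k)$. $B_m$ is the schema $(A_1\to A_2)\lor(A_2\to A_3)\lor\dots\lor(A_m\to A_{m+1})$. -}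

module Defs where

open import Level using (Level; 0ℓ)
open import Data.Nat using (ℕ; zero; suc; _≤_)
open import Data.Fin using (Fin; zero; suc; inject₁)
open import Data.Vec using (Vec; []; _∷_)
open import Data.Vec.Relation.Unary.All using (All)
open import Data.Product using (Σ-syntax; _×_)
open import Function using (_∘_; const)
open import Relation.Unary using (Pred; _∈_; _⊆_; _∪_; ∅)

private
  variable
    ℓ : Level
    n m k : ℕ

infixr 7 _∧_
infixr 6 _∨_
infixr 5 _⇒_

-- Quantifier-free formulas over an arbitrary set of atoms: propositional
-- variables give propositional formulas, atomic formulas of a first-order
-- language give the quantifier-free formulas of that language.
data Form (At : Set) : Set where
  atom        : At → Form At
  ⊥ₚ          : Form At
  _∧_ _∨_ _⇒_ : Form At → Form At → Form At

private
  variable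
    At Bt : Set

¬ₚ_ : Form At → Form At
¬ₚ A = A ⇒ ⊥ₚ

instantiate : (At → Form Bt) → Form At → Form Bt
instantiate σ (atom a) = σ a
instantiate σ ⊥ₚ       = ⊥ₚ
instantiate σ (A ∧ B)  = instantiate σ A ∧ instantiate σ B
instantiate σ (A ∨ B)  = instantiate σ A ∨ instantiate σ B
instantiate σ (A ⇒ B)  = instantiate σ A ⇒ instantiate σ B

data AllAtoms (P : Pred At 0ℓ) : Form At → Set where
  atom : ∀ {a} → P a → AllAtoms P (atom a)
  ⊥ₚ   : AllAtoms P ⊥ₚ
  _∧_  : ∀ {A B} → AllAtoms P A → AllAtoms P B → AllAtoms P (A ∧ B)
  _∨_  : ∀ {A B} → AllAtoms P A → AllAtoms P B → AllAtoms P (A ∨ B)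
  _⇒_  : ∀ {A B} → AllAtoms P A → AllAtoms P B → AllAtoms P (A ⇒ B)

-- A singleton disjunction is its only disjunct; the empty one is ⊥ₚ by
-- convention, and is never used below.
⋁ : (Fin k → Form At) → Form At
⋁ {zero}        A = ⊥ₚ
⋁ {suc zero}    A = A zero
⋁ {suc (suc k)} A = A zero ∨ ⋁ (A ∘ suc)

-- B m A is (A₁ ⇒ A₂) ∨ … ∨ (Aₘ ⇒ Aₘ₊₁), with A indexed from zero.
B : (m : ℕ) → (Fin (suc m) → Form At) → Form At
B m A = ⋁ {m} (λ i → A (inject₁ i) ⇒ A (suc i))

PropForm : Set
PropForm = Form ℕ

-- Derivability from the formulas in Γ (taken as they are) and substitution
-- instances of the propositional formulas in L, by modus ponens.
data Derivable (L : Pred PropForm ℓ) (Γ : Pred (Form At) 0ℓ) : Form At → Set ℓ where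
  hyp  : ∀ {A} → A ∈ Γ → Derivable L Γ A
  inst : ∀ {A} → A ∈ L → (σ : ℕ → Form At) → Derivable L Γ (instantiate σ A)
  mp   : ∀ {A B} → Derivable L Γ (A ⇒ B) → Derivable L Γ A → Derivable L Γ B

infix 3 _⊢_
_⊢_ : Pred PropForm ℓ → Form At → Set ℓ
L ⊢ A = Derivable L ∅ A

private
  p q r : PropForm
  p = atom 0
  q = atom 1
  r = atom 2

data IntAxiom : PropForm → Set where
  K      : IntAxiom (p ⇒ q ⇒ p)
  S      : IntAxiom ((p ⇒ q ⇒ r) ⇒ (p ⇒ q) ⇒ p ⇒ r)
  ∧-elₗ  : IntAxiom (p ∧ q ⇒ p)
  ∧-elᵣ  : IntAxiom (p ∧ q ⇒ q)
  ∧-in   : IntAxiom (p ⇒ q ⇒ p ∧ q)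
  ∨-inₗ  : IntAxiom (p ⇒ p ∨ q)
  ∨-inᵣ  : IntAxiom (q ⇒ p ∨ q)
  ∨-el   : IntAxiom ((p ⇒ r) ⇒ (q ⇒ r) ⇒ p ∨ q ⇒ r)
  ⊥-el   : IntAxiom (⊥ₚ ⇒ p)

data ExcludedMiddle : PropForm → Set where
  lem : ExcludedMiddle (p ∨ ¬ₚ p)

IntuitionisticLogic ClassicalLogic : Pred PropForm 0ℓ
IntuitionisticLogic A = IntAxiom ⊢ A
ClassicalLogic      A = IntAxiom ∪ ExcludedMiddle ⊢ A

record IsIntermediateLogic (L : Pred PropForm ℓ) : Set ℓ where
  field
    containsIntuitionistic : IntuitionisticLogic ⊆ L
    containedInClassical   : L ⊆ ClassicalLogic
    closed-mp              : ∀ {A B} → A ⇒ B ∈ L → A ∈ L → B ∈ L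
    closed-subst           : ∀ {A} (σ : ℕ → PropForm) → A ∈ L → instantiate σ A ∈ L

-- The language is left arbitrary; the usual one, with countably many function
-- and relation symbols of every arity, is the instance
-- Fun = Rel = ℕ × ℕ with both arities given by proj₁.
record Signature : Set₁ where
  field
    Fun      : Set
    funArity : Fun → ℕ
    Rel      : Set
    relArity : Rel → ℕ

module _ (𝒮 : Signature) where
  open Signature 𝒮

  -- Free variables are named by natural numbers, bound variables are
  -- well-scoped de Bruijn indices.  Terms and formulas proper are those in
  -- scope 0; `Formula n` also serves for formulas A(x₁,…,xₙ) with displayed
  -- argument places.
  mutual
    data Term (n : ℕ) : Set where
      bound : Fin n → Term n
      free  : ℕ → Term n
      fun   : (f : Fun) → Vec (Term n) (funArity f) → Term n
      ε τ   : Formula (suc n) → Term n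

    data Atomic (n : ℕ) : Set where
      rel : (R : Rel) → Vec (Term n) (relArity R) → Atomic n

    Formula : ℕ → Set
    Formula n = Form (Atomic n)

module _ {𝒮 : Signature} where
  open Signature 𝒮

  liftRen : (Fin n → Fin m) → Fin (suc n) → Fin (suc m)
  liftRen ρ zero    = zero
  liftRen ρ (suc i) = suc (ρ i)

  mutual
    renTerm : (Fin n → Fin m) → Term 𝒮 n → Term 𝒮 m
    renTerm ρ (bound i)  = bound (ρ i)
    renTerm ρ (free a)   = free a
    renTerm ρ (fun f ts) = fun f (renTerms ρ ts)
    renTerm ρ (ε A)      = ε (renFormula (liftRen ρ) A)
    renTerm ρ (τ A)      = τ (renFormula (liftRen ρ) A)

    renTerms : (Fin n → Fin m) → Vec (Term 𝒮 n) k → Vec (Term 𝒮 m) k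
    renTerms ρ []       = []
    renTerms ρ (t ∷ ts) = renTerm ρ t ∷ renTerms ρ ts

    renFormula : (Fin n → Fin m) → Formula 𝒮 n → Formula 𝒮 m
    renFormula ρ (atom (rel R ts)) = atom (rel R (renTerms ρ ts))
    renFormula ρ ⊥ₚ                = ⊥ₚ
    renFormula ρ (A ∧ B)           = renFormula ρ A ∧ renFormula ρ B
    renFormula ρ (A ∨ B)           = renFormula ρ A ∨ renFormula ρ B
    renFormula ρ (A ⇒ B)           = renFormula ρ A ⇒ renFormula ρ B

  liftSub : (Fin n → Term 𝒮 m) → Fin (suc n) → Term 𝒮 (suc m)
  liftSub σ zero    = bound zero
  liftSub σ (suc i) = renTerm suc (σ i)

  mutual
    subTerm : (Fin n → Term 𝒮 m) → Term 𝒮 n → Term 𝒮 m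
    subTerm σ (bound i)  = σ i
    subTerm σ (free a)   = free a
    subTerm σ (fun f ts) = fun f (subTerms σ ts)
    subTerm σ (ε A)      = ε (subFormula (liftSub σ) A)
    subTerm σ (τ A)      = τ (subFormula (liftSub σ) A)

    subTerms : (Fin n → Term 𝒮 m) → Vec (Term 𝒮 n) k → Vec (Term 𝒮 m) k
    subTerms σ []       = []
    subTerms σ (t ∷ ts) = subTerm σ t ∷ subTerms σ ts

    subFormula : (Fin n → Term 𝒮 m) → Formula 𝒮 n → Formula 𝒮 m
    subFormula σ (atom (rel R ts)) = atom (rel R (subTerms σ ts))
    subFormula σ ⊥ₚ                = ⊥ₚ
    subFormula σ (A ∧ B)           = subFormula σ A ∧ subFormula σ B
    subFormula σ (A ∨ B)           = subFormula σ A ∨ subFormula σ B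
    subFormula σ (A ⇒ B)           = subFormula σ A ⇒ subFormula σ B

  infix 8 _[_] _⟨_⟩

  _[_] : Formula 𝒮 n → (Fin n → Term 𝒮 0) → Formula 𝒮 0
  A [ t ] = subFormula t A

  _⟨_⟩ : Formula 𝒮 1 → Term 𝒮 0 → Formula 𝒮 0
  A ⟨ t ⟩ = A [ const t ]

  data Critical : Formula 𝒮 0 → Set where
    ε-critical : (A : Formula 𝒮 1) (t : Term 𝒮 0) → Critical (A ⟨ t ⟩ ⇒ A ⟨ ε A ⟩)
    τ-critical : (A : Formula 𝒮 1) (t : Term 𝒮 0) → Critical (A ⟨ τ A ⟩ ⇒ A ⟨ t ⟩)

  infix 3 ετ_⊢_
  ετ_⊢_ : Pred PropForm ℓ → Formula 𝒮 0 → Set ℓ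
  ετ L ⊢ A = Derivable L Critical A

  data IsετTerm : Term 𝒮 n → Set where
    ε : (A : Formula 𝒮 (suc n)) → IsετTerm (ε A)
    τ : (A : Formula 𝒮 (suc n)) → IsετTerm (τ A)

  data ετFree : Term 𝒮 n → Set where
    bound : (i : Fin n) → ετFree (bound i)
    free  : (a : ℕ) → ετFree {n} (free a)
    fun   : ∀ f {ts : Vec (Term 𝒮 n) (funArity f)} → All ετFree ts → ετFree (fun f ts)

  data ετFreeAtomic : Atomic 𝒮 n → Set where
    rel : ∀ R {ts : Vec (Term 𝒮 n) (relArity R)} → All ετFree ts → ετFreeAtomic (rel R ts)

  ετFreeFormula : Formula 𝒮 n → Set
  ετFreeFormula = AllAtoms ετFreeAtomic

-- A(x₁,…,xₙ) is a formula of the underlying first-order language, i.e. it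
-- contains no ετ-terms itself: those of A(e₁,…,eₙ) all come from the eᵢ.
-- Otherwise the property would fail for trivial reasons (n = 0 and A a
-- critical formula).
HasFirstετTheorem : Signature → Pred PropForm ℓ → Set ℓ
HasFirstετTheorem 𝒮 L =
  ∀ {n} (A : Formula 𝒮 n) → ετFreeFormula A →
  (e : Fin n → Term 𝒮 0) → (∀ i → IsετTerm (e i)) →
  ετ L ⊢ A [ e ] →
  Σ[ k ∈ ℕ ] Σ[ t ∈ (Fin k → Fin n → Term 𝒮 0) ] 1 ≤ k
    × (∀ j i → ετFree (t j i))
    × (L ⊢ ⋁ (λ j → A [ t j ]))

{-# OPTIONS --safe #-}

-- Write P(x) for R(x,…,x) and f(x) for f(x,…,x), and let e = τx P(x).  The
-- formula P(e) ⇒ P(f(e)) is critical, so the first ετ-theorem yields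
-- ετ-free terms t₁,…,tₖ with L ⊢ ⋁ⱼ (P(tⱼ) ⇒ P(f(tⱼ))).  Replacing every
-- atom P(t) by A_d, where d is 1 plus the nesting depth of t,
-- turns each disjunct into some A_d ⇒ A_{d+1}, hence into a disjunct of Bₘ
-- once m exceeds all the depths that occur.
module Submission where

open import Level using (Level)
open import Data.Nat using (ℕ; zero; suc; _+_; _≤_; _<_; s≤s; _⊔_)
open import Data.Nat.Properties using (≤-trans; m≤m⊔n; m≤n⊔m; m≤m+n; m≤n⇒m≤1+n)
open import Data.Fin using (Fin; zero; suc; inject₁)
open import Data.Vec using (Vec; []; _∷_; replicate)
open import Data.Vec.Relation.Unary.All using (All; []; _∷_)
open import Data.Product using (∃-syntax; _×_; _,_)
open import Function using (_∘_; const)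
open import Relation.Unary using (Pred; _⊆_)
open import Relation.Binary.PropositionalEquality
  using (_≡_; refl; sym; trans; cong; cong₂; subst)
open import Defs

private
  variable
    ℓ : Level
    At Bt : Set
    m n k : ℕ

instantiate-∘ : (σ : At → Form Bt) (ρ : ℕ → Form At) (A : PropForm) →
  instantiate (instantiate σ ∘ ρ) A ≡ instantiate σ (instantiate ρ A)
instantiate-∘ σ ρ (atom a) = refl
instantiate-∘ σ ρ ⊥ₚ       = refl
instantiate-∘ σ ρ (A ∧ B)  = cong₂ _∧_ (instantiate-∘ σ ρ A) (instantiate-∘ σ ρ B)
instantiate-∘ σ ρ (A ∨ B)  = cong₂ _∨_ (instantiate-∘ σ ρ A) (instantiate-∘ σ ρ B)
instantiate-∘ σ ρ (A ⇒ B)  = cong₂ _⇒_ (instantiate-∘ σ ρ A) (instantiate-∘ σ ρ B)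

instantiate-⋁ : (σ : At → Form Bt) (A : Fin k → Form At) →
  instantiate σ (⋁ A) ≡ ⋁ (instantiate σ ∘ A)
instantiate-⋁ {k = zero}        σ A = refl
instantiate-⋁ {k = suc zero}    σ A = refl
instantiate-⋁ {k = suc (suc k)} σ A =
  cong (instantiate σ (A zero) ∨_) (instantiate-⋁ σ (A ∘ suc))

-- An instance of an instance is again an instance, and `L ⊢` has no hypotheses to preserve, so `σ`
-- may even change the set of atoms. This carries derivations from the first-order language back to
-- propositional formulas.
⊢-instantiate : {L : Pred PropForm ℓ} (σ : At → Form Bt) {A : Form At} →
  L ⊢ A → L ⊢ instantiate σ A
⊢-instantiate {L = L} σ (inst {A} A∈L ρ) =
  subst (L ⊢_) (instantiate-∘ σ ρ A) (inst A∈L (instantiate σ ∘ ρ))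
⊢-instantiate σ (mp d e) = mp (⊢-instantiate σ d) (⊢-instantiate σ e)

module Intuitionistic {L : Pred PropForm ℓ} (int : IntuitionisticLogic ⊆ L) where

  private
    variable
      A C D : Form At

    values : Form At → Form At → Form At → ℕ → Form At
    values A C D 0 = A
    values A C D 1 = C
    values A C D _ = D

    -- Membership in `IntuitionisticLogic` is itself derivability, whose rule `inst` yields
    -- `instantiate atom X` rather than `X`. On a concrete axiom both instantiations compute away.
    axiom : {X : PropForm} → IntAxiom X → (σ : ℕ → Form At) →
      L ⊢ instantiate σ (instantiate atom X)
    axiom ax = inst (int (inst ax atom))

  ⇒-refl : L ⊢ A ⇒ A
  ⇒-refl {A = A} = mp (mp (axiom S (values A (A ⇒ A) A)) (axiom K (values A (A ⇒ A) A)))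
                      (axiom K (values A A A))

  ⇒-trans : L ⊢ A ⇒ C → L ⊢ C ⇒ D → L ⊢ A ⇒ D
  ⇒-trans {A = A} {C = C} {D = D} d e =
    mp (mp (axiom S (values A C D)) (mp (axiom K (values (C ⇒ D) A A)) e)) d

  ∨-introˡ : L ⊢ A ⇒ A ∨ C
  ∨-introˡ {A = A} {C = C} = axiom ∨-inₗ (values A C A)

  ∨-introʳ : L ⊢ C ⇒ A ∨ C
  ∨-introʳ {C = C} {A = A} = axiom ∨-inᵣ (values A C A)

  ∨-elim : L ⊢ A ⇒ D → L ⊢ C ⇒ D → L ⊢ A ∨ C ⇒ D
  ∨-elim {A = A} {D = D} {C = C} d e = mp (mp (axiom ∨-el (values A C D)) d) e

  ⋁-intro : (A : Fin k → Form At) (i : Fin k) → L ⊢ A i ⇒ ⋁ A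
  ⋁-intro {k = suc zero}    A zero    = ⇒-refl
  ⋁-intro {k = suc (suc k)} A zero    = ∨-introˡ
  ⋁-intro {k = suc (suc k)} A (suc i) = ⇒-trans (⋁-intro (A ∘ suc) i) ∨-introʳ

  ⋁-elim : (A : Fin k → Form At) → (∀ i → L ⊢ A i ⇒ D) → L ⊢ ⋁ A ⇒ D
  ⋁-elim {k = zero} {D = D} A d = axiom ⊥-el (values D D D)
  ⋁-elim {k = suc zero}     A d = d zero
  ⋁-elim {k = suc (suc k)}  A d = ∨-elim (d zero) (⋁-elim (A ∘ suc) (d ∘ suc))

-- Truncation at `m` extends a family indexed by `Fin (suc m)` to all depths, constant from `m` on.
clamp : ∀ m → ℕ → Fin (suc m)
clamp m       zero    = zero
clamp zero    (suc d) = zero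
clamp (suc m) (suc d) = suc (clamp m d)

clamp-consecutive : ∀ {d} → d < m →
  ∃[ i ] (inject₁ i ≡ clamp m d × suc i ≡ clamp m (suc d))
clamp-consecutive {m = suc m} {zero}  _       = zero , refl , refl
clamp-consecutive {m = suc m} {suc d} (s≤s d<m) with clamp-consecutive d<m
... | i , eq , eq′ = suc i , cong suc eq , cong suc eq′

upperBound : (h : Fin k → ℕ) → ∃[ b ] (∀ j → h j ≤ b)
upperBound {k = zero}  h = 0 , λ ()
upperBound {k = suc k} h with upperBound (h ∘ suc)
... | b , h≤b = h zero ⊔ b , λ where
  zero    → m≤m⊔n (h zero) b
  (suc j) → ≤-trans (h≤b j) (m≤n⊔m (h zero) b)

module _ {𝒮 : Signature} where
  open Signature 𝒮

  -- Only first arguments are followed, and the names of function symbols are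
  -- ignored, because equality of symbols need not be decidable.
  mutual
    depth : Term 𝒮 n → ℕ
    depth (fun f ts) = argDepth ts
    depth _          = 0

    argDepth : Vec (Term 𝒮 n) k → ℕ
    argDepth []      = 0
    argDepth (t ∷ _) = suc (depth t)

  -- Positive arity guarantees a first argument to follow; matching on the inequality exposes it,
  -- and both sides then compute.
  argDepth-replicate : (σ : Fin n → Term 𝒮 m) (s : Term 𝒮 n) → 1 ≤ k →
    argDepth (subTerms σ (replicate k s)) ≡ suc (depth (subTerm σ s))
  argDepth-replicate σ s (s≤s _) = refl

  subTerms-replicate : ∀ k (σ : Fin n → Term 𝒮 m) (s : Term 𝒮 n) →
    subTerms σ (replicate k s) ≡ replicate k (subTerm σ s)
  subTerms-replicate zero    σ s = refl
  subTerms-replicate (suc k) σ s = cong (subTerm σ s ∷_) (subTerms-replicate k σ s)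

  All-ετFree-replicate : ∀ k {s : Term 𝒮 n} → ετFree s → All ετFree (replicate k s)
  All-ετFree-replicate zero    s-free = []
  All-ετFree-replicate (suc k) s-free = s-free ∷ All-ετFree-replicate k s-free

module Diagonal (𝒮 : Signature) (f : Signature.Fun 𝒮) (R : Signature.Rel 𝒮) where
  open Signature 𝒮

  apply : Term 𝒮 n → Term 𝒮 n
  apply t = fun f (replicate _ t)

  P : Term 𝒮 n → Formula 𝒮 n
  P t = atom (rel R (replicate _ t))

  subFormula-P : (σ : Fin n → Term 𝒮 m) (t : Term 𝒮 n) →
    subFormula σ (P t) ≡ P (subTerm σ t)
  subFormula-P σ t = cong (λ ts → atom (rel R ts)) (subTerms-replicate _ σ t)

  step : Formula 𝒮 1
  step = P (bound zero) ⇒ P (apply (bound zero))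

  step-ετFree : ετFreeFormula step
  step-ετFree = atom (rel R (All-ετFree-replicate _ (bound zero)))
              ⇒ atom (rel R (All-ετFree-replicate _ apply-ετFree))
    where
    apply-ετFree : ετFree (apply {1} (bound zero))
    apply-ετFree = fun f (All-ετFree-replicate _ (bound zero))

  witness : Term 𝒮 0
  witness = τ (P (bound zero))

  step-critical : Critical (step ⟨ witness ⟩)
  step-critical =
    -- At an unknown arity `replicate` does not reduce, so the two conclusions agree only
    -- propositionally; both equal `P t`.
    subst (λ X → Critical (P (bound zero) ⟨ witness ⟩ ⇒ X))
      (trans (subFormula-P (const t) (bound zero))
             (sym (subFormula-P (const witness) (apply (bound zero)))))
      (τ-critical (P (bound zero)) t)
    where
    t : Term 𝒮 0
    t = subTerm (const witness) (apply (bound zero))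

  atomDepth : Atomic 𝒮 0 → ℕ
  atomDepth (rel _ ts) = argDepth ts

  stepDepth : (Fin 1 → Term 𝒮 0) → ℕ
  stepDepth t = suc (depth (t zero))

  -- The relation symbol adds one level on both sides and `f` one more on the right, whence
  -- consecutive indices.
  instantiate-step : 1 ≤ funArity f → 1 ≤ relArity R →
    (V : ℕ → PropForm) (t : Fin 1 → Term 𝒮 0) →
    instantiate (V ∘ atomDepth) (step [ t ]) ≡ (V (stepDepth t) ⇒ V (suc (stepDepth t)))
  instantiate-step 1≤f 1≤R V t = cong₂ (λ a b → V a ⇒ V b)
    (argDepth-replicate t (bound zero) 1≤R)
    (trans (argDepth-replicate t (apply (bound zero)) 1≤R)
           (cong suc (argDepth-replicate t (bound zero) 1≤f)))

mainTheorem3 : {ℓ : Level} (𝒮 : Signature) →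
    (∃[ f ] 1 ≤ Signature.funArity 𝒮 f) →
    (∃[ R ] 1 ≤ Signature.relArity 𝒮 R) →
    (L : Pred PropForm ℓ) → IsIntermediateLogic L →
    HasFirstετTheorem 𝒮 L →
    ∃[ m ] (2 ≤ m × ((A : Fin (suc m) → PropForm) → L ⊢ B m A))
mainTheorem3 𝒮 (f , 1≤f) (R , 1≤R) L isIntermediate first
  with first step step-ετFree (const witness) (λ _ → τ _) (hyp step-critical)
  where open Diagonal 𝒮 f R
... | k , t , _ , _ , ⊢steps
  with upperBound (λ j → Diagonal.stepDepth 𝒮 f R (t j))
-- The summand 2 gives `2 ≤ m` at once and keeps every `stepDepth` strictly below `m`.
... | b , depth≤b = 2 + b , m≤m+n 2 b , ⊢B
  where
  open Diagonal 𝒮 f R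
  open Intuitionistic (IsIntermediateLogic.containsIntuitionistic isIntermediate)

  ⊢B : (A : Fin (3 + b) → PropForm) → L ⊢ B (2 + b) A
  -- Different `j` may land in the same disjunct of `B`, so the derived disjunction is eliminated
  -- case by case.
  ⊢B A = mp (⋁-elim _ disjunct)
            (subst (L ⊢_) (instantiate-⋁ σ (λ j → step [ t j ])) (⊢-instantiate σ ⊢steps))
    where
    V : ℕ → PropForm
    V = A ∘ clamp (2 + b)

    σ : Atomic 𝒮 0 → PropForm
    σ = V ∘ atomDepth

    disjunct : ∀ j → L ⊢ instantiate σ (step [ t j ]) ⇒ B (2 + b) A
    disjunct j
      rewrite instantiate-step 1≤f 1≤R V (t j)
      -- Since the depth is below `2 + b`, truncation alters neither it nor its successor.
      with clamp-consecutive (s≤s (m≤n⇒m≤1+n (depth≤b j)))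
    ... | i , eq , eq′ =
      subst (λ X → L ⊢ X ⇒ B (2 + b) A) (cong₂ (λ x y → A x ⇒ A y) eq eq′)
        (⋁-intro (λ i → A (inject₁ i) ⇒ A (suc i)) i)
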